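{- The proportion of the Latin squares in the ensemble of an $\mathrm{OA}(k,n)$ that are equiparity is no more than $\frac14+o(1)$ as $n,k\to\infty$ with $n\equiv 2,3\pmod 4$. That is, for every $\varepsilon>0$ there is $K_0$ such that for all integers $n,k\ge K_0$ with $3\le k\le n+1$ and $n\equiv 2$ or $3\pmod 4$, and for every $\mathrm{OA}(k,n)$, at most $\left(\frac14+\varepsilon\right)\binom{k}{3}$ of the $\binom{k}{3}$ Latin squares in its ensemble are equiparity.
   Context: An orthogonal array $\mathrm{OA}(k,n)$ on an alphabet $\Lambda$ with $|\Lambda|=n$ is an $n^2\times k$ matrix $A=(a_{r\ell})$ with entries in $\Lambda$ such that in every pair of distinct columns each ordered pair in $\Lambda^2$ occurs in exactly one row. The ensemble of $A$ is the family of Latin squares indexed by the $\binom{k}{3}$ choices of columns $i<j<\ell$ of $A$ (Latin squares are counted once for each choice of three columns): the Latin square for $i<j<\ell$ has rows and columns indexed by $\Lambda$, and for each row $r$ of $A$ its entry in row $a_{ri}$, column $a_{rj}$ is $a_{r\ell}$. For a Latin square $L=(l_{xy})$ with rows, columns and symbols indexed by $\Lambda$, the row-parity $\pi_r\in\mathbb{Z}_2$ is the sum of the parities ($0$ even, $1$ odd) of the $n$ permutations $y\mapsto l_{xy}$ ($x\in\Lambda$ fixed); the column-parity $\pi_c$ is the sum of the parities of the $n$ permutations $x\mapsto l_{xy}$ ($y$ fixed); the symbol-parity $\pi_s$ is the sum of the parities of the $n$ permutations mapping $x\mapsto y$ whenever $l_{xy}=s$ ($s$ fixed). $L$ is equiparity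 if $\pi_r=\pi_c=\pi_s$. -}

module Defs where

open import Data.Fin.Base using (Fin; _<_)
open import Data.Fin.Permutation using (Permutation′; permutation; _⟨$⟩ʳ_)
open import Data.Fin.Properties using (_<?_; <⇒≢; <-trans)
open import Data.List.Base
  using (List; length; filter; map; mapMaybe; allFin; cartesianProduct)
open import Data.Maybe.Base as Maybe using (Maybe)
open import Data.Nat.Base using (ℕ; _^_; parity)
open import Data.Parity.Base using (Parity)
open import Data.Parity.Properties using (+-0-commutativeMonoid) renaming (_≟_ to _≟ℙ_)
open import Data.Product using (_×_; _,_; ∃!; proj₁; proj₂)
open import Function.Base using (_∘_)
open import Relation.Binary.PropositionalEquality using (_≡_; _≢_; refl; sym; trans; cong)
open import Relation.Nullary.Decidable using (Dec; _×-dec_; dec⇒maybe)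

open import Algebra.Properties.CommutativeMonoid.Sum +-0-commutativeMonoid using (sum)

private
  variable
    n k : ℕ

-- The alphabet Λ is Fin n throughout; relabelling Λ does not change the parity
-- of a permutation, so fixing this enumeration loses nothing.

inversions : Permutation′ n → ℕ
inversions {n} π =
  length (filter (λ (a , b) → (a <? b) ×-dec ((π ⟨$⟩ʳ b) <? (π ⟨$⟩ʳ a)))
                 (cartesianProduct (allFin n) (allFin n)))

permParity : Permutation′ n → Parity
permParity π = parity (inversions π)

record LatinSquare (n : ℕ) : Set where
  field
    entry    : Fin n → Fin n → Fin n
    inRow    : ∀ x s → ∃! _≡_ (λ y → entry x y ≡ s)
    inColumn : ∀ y s → ∃! _≡_ (λ x → entry x y ≡ s)

  rowPerm : Fin n → Permutation′ n
  rowPerm x = permutation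
    (entry x)
    (λ s → proj₁ (inRow x s))
    (λ s → proj₁ (proj₂ (inRow x s)))
    (λ y → proj₂ (proj₂ (inRow x (entry x y))) refl)

  columnPerm : Fin n → Permutation′ n
  columnPerm y = permutation
    (λ x → entry x y)
    (λ s → proj₁ (inColumn y s))
    (λ s → proj₁ (proj₂ (inColumn y s)))
    (λ x → proj₂ (proj₂ (inColumn y (entry x y))) refl)

  symbolPerm : Fin n → Permutation′ n
  symbolPerm s = permutation
    (λ x → proj₁ (inRow x s))
    (λ y → proj₁ (inColumn y s))
    (λ y → proj₂ (proj₂ (inRow _ s)) (proj₁ (proj₂ (inColumn y s))))
    (λ x → proj₂ (proj₂ (inColumn _ s)) (proj₁ (proj₂ (inRow x s))))

  rowParity columnParity symbolParity : Parity
  rowParity    = sum (permParity ∘ rowPerm)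
  columnParity = sum (permParity ∘ columnPerm)
  symbolParity = sum (permParity ∘ symbolPerm)

open LatinSquare public

Equiparity : LatinSquare n → Set
Equiparity L = rowParity L ≡ columnParity L × columnParity L ≡ symbolParity L

equiparity? : (L : LatinSquare n) → Dec (Equiparity L)
equiparity? L =
  (rowParity L ≟ℙ columnParity L) ×-dec (columnParity L ≟ℙ symbolParity L)

record OA (k n : ℕ) : Set where
  field
    array      : Fin (n ^ 2) → Fin k → Fin n
    orthogonal : ∀ i j → i ≢ j → ∀ x y →
                 ∃! _≡_ (λ r → array r i ≡ x × array r j ≡ y)

  rowAt : ∀ {i j} → i ≢ j → Fin n → Fin n → Fin (n ^ 2)
  rowAt i≢j x y = proj₁ (orthogonal _ _ i≢j x y)

  rowAt-fst : ∀ {i j} (i≢j : i ≢ j) x y → array (rowAt i≢j x y) i ≡ x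
  rowAt-fst i≢j x y = proj₁ (proj₁ (proj₂ (orthogonal _ _ i≢j x y)))

  rowAt-snd : ∀ {i j} (i≢j : i ≢ j) x y → array (rowAt i≢j x y) j ≡ y
  rowAt-snd i≢j x y = proj₂ (proj₁ (proj₂ (orthogonal _ _ i≢j x y)))

  rowAt-unique : ∀ {i j} (i≢j : i ≢ j) {x y r} →
                 array r i ≡ x → array r j ≡ y → rowAt i≢j x y ≡ r
  rowAt-unique i≢j p q = proj₂ (proj₂ (orthogonal _ _ i≢j _ _)) (p , q)

  square : ∀ {i j ℓ} → i < j → j < ℓ → LatinSquare n
  square {i} {j} {ℓ} i<j j<ℓ = record
    { entry    = λ x y → array (rowAt i≢j x y) ℓ
    ; inRow    = λ x s →
        let r = rowAt i≢ℓ x s in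
        array r j ,
        trans (cong (λ r′ → array r′ ℓ) (rowAt-unique i≢j (rowAt-fst i≢ℓ x s) refl))
              (rowAt-snd i≢ℓ x s) ,
        λ {y} e → trans
          (cong (λ r′ → array r′ j) (rowAt-unique i≢ℓ (rowAt-fst i≢j x y) e))
          (rowAt-snd i≢j x y)
    ; inColumn = λ y s →
        let r = rowAt j≢ℓ y s in
        array r i ,
        trans (cong (λ r′ → array r′ ℓ) (rowAt-unique i≢j refl (rowAt-fst j≢ℓ y s)))
              (rowAt-snd j≢ℓ y s) ,
        λ {x} e → trans
          (cong (λ r′ → array r′ i) (rowAt-unique j≢ℓ (rowAt-snd i≢j x y) e))
          (rowAt-fst i≢j x y)
    }
    where
    i≢j : i ≢ j
    i≢j = <⇒≢ i<j
    j≢ℓ : j ≢ ℓ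
    j≢ℓ = <⇒≢ j<ℓ
    i≢ℓ : i ≢ ℓ
    i≢ℓ = <⇒≢ (<-trans i<j j<ℓ)

open OA public

record Triple (k : ℕ) : Set where
  constructor triple
  field
    {fst snd thd} : Fin k
    fst<snd       : fst < snd
    snd<thd       : snd < thd

toTriple : Fin k × Fin k × Fin k → Maybe (Triple k)
toTriple (i , j , ℓ) =
  Maybe.map (λ (p , q) → triple p q) (dec⇒maybe ((i <? j) ×-dec (j <? ℓ)))

triples : ∀ k → List (Triple k)
triples k = mapMaybe toTriple
  (cartesianProduct (allFin k) (cartesianProduct (allFin k) (allFin k)))

-- A list, so that equal squares arising from different choices of columns
-- are counted separately.
ensemble : OA k n → List (LatinSquare n)
ensemble {k} A = map (λ (triple p q) → square A p q) (triples k)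

equiparityCount : OA k n → ℕ
equiparityCount A = length (filter equiparity? (ensemble A))

{-# OPTIONS --safe #-}
module Submission where

-- For distinct columns c, a, b let t(c; a, b) be the parity of the permutations
-- that a induces on b inside the symbols of c; the row-, column- and symbol-parity
-- of the square on i < j < ℓ are t(i; j, ℓ), t(j; i, ℓ) and t(ℓ; i, j).  Counting
-- pairs of rows on which two columns are oppositely ordered shows that these three
-- sum to 3 (n C 2)² modulo 2, which is odd, so a square has three odd parities if
-- it is equiparity and exactly one otherwise: with E equiparity squares among
-- T = k C 3, there are T + 2E odd values t(c; a, b).  As permutation parity is a
-- homomorphism, t(c; a, b) + t(c; b, d) = t(c; a, d), so for fixed c the odd pairs
-- form a cut of k − 1 columns and number at most (k − 1)² / 4.  Hence
-- T + 2E ≤ k (k − 1)² / 4, that is, 4 (k − 2) E ≤ (k + 1) T.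

open import Defs
open import Data.Bool.Base using (true; false; if_then_else_)
open import Data.Empty using (⊥-elim)
open import Data.Fin.Base as Fin using (Fin; zero; suc)
open import Data.Fin.Permutation using (Permutation′; _⟨$⟩ʳ_)
open import Data.Fin.Properties as Fin using (_<?_; _≟_)
open import Data.List.Base as List using (List; []; _∷_)
import Data.List.Properties as List
open import Data.Maybe.Base as Maybe using (Maybe; just; nothing; maybe′)
open import Data.Nat.Base using (ℕ; zero; suc; _≤_; _≥_; _+_; _*_; _^_; _%_; parity; z≤n; s≤s)
open import Data.Nat.Properties hiding (_<?_; _≟_)
open import Data.Nat.Coprimality using (Coprime)
import Data.Nat.ListAction as ListAction
import Data.Nat.ListAction.Properties as ListAction
open import Data.Nat.Combinatorics using (_C_; nC1≡n; nCk+nC[k+1]≡[n+1]C[k+1])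
open import Data.Nat.DivMod using ([m+n]%n≡m%n)
open import Data.Nat.Tactic.RingSolver using (solve-∀)
open import Data.Parity.Base as ℙ using (Parity; 0ℙ; 1ℙ)
import Data.Parity.Properties as ℙ
open import Data.Rational.Base as ℚ using (ℚ; 0ℚ; _/_)
open import Data.Product using (∃-syntax; _×_; _,_)
open import Data.Sum.Base using (_⊎_; inj₁; inj₂)
open import Function.Base using (_∘_)
open import Relation.Binary.PropositionalEquality
open import Relation.Nullary.Decidable using (Dec; does; yes; no; _×-dec_; dec⇒maybe)
open import Relation.Unary using (Pred; Decidable)

open import Algebra.Properties.Semiring.Sum +-*-semiring renaming (sum-cong-≗ to sum-cong)
import Algebra.Properties.CommutativeMonoid.Sum ℙ.+-0-commutativeMonoid as ℙSum

private
  variable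
    A B : Set
    k n N : ℕ

-- Comparisons of indices, and sums over Fin n

-- Comparisons carry tests with values 0 and 1 in `ℕ`, so every count becomes a sum and every
-- pointwise identity a finite case check.
data Order : Set where
  lt eq gt : Order

flip : Order → Order
flip lt = gt
flip eq = eq
flip gt = lt

isLt isEq isGt isNe : Order → ℕ
isLt lt = 1
isLt eq = 0
isLt gt = 0
isEq lt = 0
isEq eq = 1
isEq gt = 0
isGt lt = 0
isGt eq = 0
isGt gt = 1
isNe lt = 1
isNe eq = 0
isNe gt = 1

isLt-flip : ∀ o → isLt (flip o) ≡ isGt o
isLt-flip lt = refl
isLt-flip eq = refl
isLt-flip gt = refl

isGt-flip : ∀ o → isGt (flip o) ≡ isLt o
isGt-flip lt = refl
isGt-flip eq = refl
isGt-flip gt = refl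

isEq-flip : ∀ o → isEq (flip o) ≡ isEq o
isEq-flip lt = refl
isEq-flip eq = refl
isEq-flip gt = refl

ord : Fin n → Fin n → Order
ord zero    zero    = eq
ord zero    (suc _) = lt
ord (suc _) zero    = gt
ord (suc i) (suc j) = ord i j

ord-flip : (i j : Fin n) → ord j i ≡ flip (ord i j)
ord-flip zero    zero    = refl
ord-flip zero    (suc j) = refl
ord-flip (suc i) zero    = refl
ord-flip (suc i) (suc j) = ord-flip i j

ord-refl : (i : Fin n) → ord i i ≡ eq
ord-refl zero    = refl
ord-refl (suc i) = ord-refl i

ord-eq : (i j : Fin n) → ord i j ≡ eq → i ≡ j
ord-eq zero    zero    _ = refl
ord-eq (suc i) (suc j) e = cong suc (ord-eq i j e)

isEq-≢ : {i j : Fin n} → i ≢ j → isEq (ord i j) ≡ 0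
isEq-≢ {i = i} {j} i≢j with ord i j in e
... | lt = refl
... | eq = ⊥-elim (i≢j (ord-eq i j e))
... | gt = refl

indicator : ∀ {P : Set} → Dec P → ℕ
indicator d = if does d then 1 else 0

isLt-indicator : (i j : Fin n) → isLt (ord i j) ≡ indicator (i <? j)
isLt-indicator zero    zero    = refl
isLt-indicator zero    (suc j) = refl
isLt-indicator (suc i) zero    = refl
isLt-indicator (suc i) (suc j) = isLt-indicator i j

sum-cong₂ : {f g : Fin k → Fin n → ℕ} → (∀ i j → f i j ≡ g i j) →
            ∑[ i < k ] ∑[ j < n ] f i j ≡ ∑[ i < k ] ∑[ j < n ] g i j
sum-cong₂ e = sum-cong λ i → sum-cong (e i)

sum-distrib₂ : (f g : Fin k → Fin n → ℕ) →
               ∑[ i < k ] ∑[ j < n ] (f i j + g i j) ≡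
               ∑[ i < k ] ∑[ j < n ] f i j + ∑[ i < k ] ∑[ j < n ] g i j
sum-distrib₂ f g =
  trans (sum-cong λ i → ∑-distrib-+ (f i) (g i))
        (∑-distrib-+ (λ i → sum (f i)) (λ i → sum (g i)))

sum-product : (f : Fin k → ℕ) (g : Fin n → ℕ) →
              sum f * sum g ≡ ∑[ i < k ] ∑[ j < n ] (f i * g j)
sum-product f g = trans (*-distribʳ-sum (sum g) f) (sum-cong λ i → *-distribˡ-sum (f i) g)

sum-zero : {f : Fin n → ℕ} → (∀ i → f i ≡ 0) → sum f ≡ 0
sum-zero {n} e = trans (sum-cong e) (sum-replicate-zero n)

-- `isEq (ord i j)` is the Kronecker delta; it serves below to introduce and to eliminate summation
-- variables.
sum-isEq : (i : Fin n) (f : Fin n → ℕ) → ∑[ j < n ] (isEq (ord i j) * f j) ≡ f i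
sum-isEq {suc n} zero f =
  trans (cong (λ s → f zero + 0 + s) (sum-zero {n} λ _ → refl)) (trans (+-identityʳ _) (+-identityʳ _))
sum-isEq (suc i) f = sum-isEq i (f ∘ suc)

-- The hypotheses make `ρ` the inverse of `r ↦ (α r , β r)`. Deltas at the two coordinates introduce
-- `x` and `y`; after the sums are exchanged, their product pins `r` to `ρ x y`.
sum-reindex :
  (α β : Fin N → Fin n) (ρ : Fin n → Fin n → Fin N) →
  (∀ x y → α (ρ x y) ≡ x) → (∀ x y → β (ρ x y) ≡ y) →
  (∀ r → ρ (α r) (β r) ≡ r) →
  (f : Fin N → ℕ) → sum f ≡ ∑[ x < n ] ∑[ y < n ] f (ρ x y)
sum-reindex {N} {n} α β ρ αρ βρ ραβ f = begin
  ∑[ r < N ] f r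
    ≡⟨ sum-cong (λ r → sym (trans (sum-isEq (α r) _) (sum-isEq (β r) (λ _ → f r)))) ⟩
  ∑[ r < N ] ∑[ x < n ] (isEq (ord (α r) x) * (∑[ y < n ] (isEq (ord (β r) y) * f r)))
    ≡⟨ sum-cong₂ (λ r x → *-distribˡ-sum (isEq (ord (α r) x)) (λ y → isEq (ord (β r) y) * f r)) ⟩
  ∑[ r < N ] ∑[ x < n ] ∑[ y < n ] (isEq (ord (α r) x) * (isEq (ord (β r) y) * f r))
    ≡⟨ ∑-comm (λ r x → ∑[ y < n ] (isEq (ord (α r) x) * (isEq (ord (β r) y) * f r))) ⟩
  ∑[ x < n ] ∑[ r < N ] ∑[ y < n ] (isEq (ord (α r) x) * (isEq (ord (β r) y) * f r))
    ≡⟨ sum-cong (λ x → ∑-comm (λ r y → isEq (ord (α r) x) * (isEq (ord (β r) y) * f r))) ⟩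
  ∑[ x < n ] ∑[ y < n ] ∑[ r < N ] (isEq (ord (α r) x) * (isEq (ord (β r) y) * f r))
    ≡⟨ sum-cong₂ (λ x y → trans (sum-cong (coordinates x y)) (sum-isEq (ρ x y) f)) ⟩
  ∑[ x < n ] ∑[ y < n ] f (ρ x y) ∎
  where
  open ≡-Reasoning

  coordinates : ∀ x y r → isEq (ord (α r) x) * (isEq (ord (β r) y) * f r) ≡
                          isEq (ord (ρ x y) r) * f r
  coordinates x y r with ρ x y ≟ r
  ... | yes refl rewrite αρ x y | βρ x y | ord-refl x | ord-refl y | ord-refl (ρ x y) = +-identityʳ _
  ... | no ρ≢r rewrite isEq-≢ ρ≢r with α r ≟ x
  ...   | no α≢x rewrite isEq-≢ α≢x = refl
  ...   | yes refl with β r ≟ y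
  ...     | no β≢y rewrite isEq-≢ β≢y = *-zeroʳ (isEq (ord (α r) (α r)))
  ...     | yes refl = ⊥-elim (ρ≢r (ραβ r))

-- Transposing the half with `i > j` folds it onto the half with `i < j`, so each unordered pair is
-- visited once.
sum-ordered : (g : Fin n → Fin n → ℕ) →
              ∑[ i < n ] ∑[ j < n ] g i j ≡
              ∑[ i < n ] g i i + ∑[ i < n ] ∑[ j < n ] (isLt (ord i j) * (g i j + g j i))
sum-ordered {n} g = begin
  ∑[ i < n ] ∑[ j < n ] g i j
    ≡⟨ sum-cong₂ split ⟩
  ∑[ i < n ] ∑[ j < n ] (isEq (ord i j) * g i j + (isLt (ord i j) * g i j + isGt (ord i j) * g i j))
    ≡⟨ sum-distrib₂ (λ i j → isEq (ord i j) * g i j) _ ⟩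
  ∑[ i < n ] ∑[ j < n ] (isEq (ord i j) * g i j) +
  ∑[ i < n ] ∑[ j < n ] (isLt (ord i j) * g i j + isGt (ord i j) * g i j)
    ≡⟨ cong₂ _+_ (sum-cong (λ i → sum-isEq i (g i))) upper ⟩
  ∑[ i < n ] g i i + ∑[ i < n ] ∑[ j < n ] (isLt (ord i j) * (g i j + g j i)) ∎
  where
  open ≡-Reasoning

  split : ∀ i j → g i j ≡ isEq (ord i j) * g i j + (isLt (ord i j) * g i j + isGt (ord i j) * g i j)
  split i j with ord i j
  ... | lt = sym (trans (+-identityʳ _) (+-identityʳ _))
  ... | eq = sym (trans (+-identityʳ _) (+-identityʳ _))
  ... | gt = sym (+-identityʳ _)

  upper : ∑[ i < n ] ∑[ j < n ] (isLt (ord i j) * g i j + isGt (ord i j) * g i j) ≡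
          ∑[ i < n ] ∑[ j < n ] (isLt (ord i j) * (g i j + g j i))
  upper = begin
    ∑[ i < n ] ∑[ j < n ] (isLt (ord i j) * g i j + isGt (ord i j) * g i j)
      ≡⟨ sum-distrib₂ (λ i j → isLt (ord i j) * g i j) _ ⟩
    ∑[ i < n ] ∑[ j < n ] (isLt (ord i j) * g i j) + ∑[ i < n ] ∑[ j < n ] (isGt (ord i j) * g i j)
      ≡⟨ cong (λ s → ∑[ i < n ] ∑[ j < n ] (isLt (ord i j) * g i j) + s)
           (trans (∑-comm (λ i j → isGt (ord i j) * g i j))
                  (sum-cong₂ λ i j → cong (_* g j i)
                    (trans (cong isGt (ord-flip i j)) (isGt-flip (ord i j))))) ⟩
    ∑[ i < n ] ∑[ j < n ] (isLt (ord i j) * g i j) + ∑[ i < n ] ∑[ j < n ] (isLt (ord i j) * g j i)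
      ≡⟨ sum-distrib₂ (λ i j → isLt (ord i j) * g i j) _ ⟨
    ∑[ i < n ] ∑[ j < n ] (isLt (ord i j) * g i j + isLt (ord i j) * g j i)
      ≡⟨ sum-cong₂ (λ i j → *-distribˡ-+ (isLt (ord i j)) (g i j) (g j i)) ⟨
    ∑[ i < n ] ∑[ j < n ] (isLt (ord i j) * (g i j + g j i)) ∎

-- Parities of sums

parity-2* : ∀ m → parity (2 * m) ≡ 0ℙ
parity-2* m = ℙ.*-homo-* 2 m

parity-sum : (f : Fin n → ℕ) → parity (sum f) ≡ ℙSum.sum (parity ∘ f)
parity-sum {zero}  f = refl
parity-sum {suc n} f =
  trans (ℙ.+-homo-+ (f zero) _) (cong (parity (f zero) ℙ.+_) (parity-sum (f ∘ suc)))

parity-sum-zero : {f : Fin n → ℕ} → (∀ i → parity (f i) ≡ 0ℙ) → parity (sum f) ≡ 0ℙ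
parity-sum-zero {n} {f} e =
  trans (parity-sum f) (trans (ℙSum.sum-cong-≗ e) (ℙSum.sum-replicate-zero n))

-- The terms at `(i , j)` and `(j , i)` cancel modulo 2. This reduces congruences between counts of
-- pairs of rows to case checks on a few comparisons.
parity-symmetric : (h : Fin n → Fin n → ℕ) → (∀ i → h i i ≡ 0) →
                   (∀ i j → parity (h i j) ≡ parity (h j i)) →
                   parity (∑[ i < n ] ∑[ j < n ] h i j) ≡ 0ℙ
parity-symmetric {n} h diagonal symmetric = begin
  parity (∑[ i < n ] ∑[ j < n ] h i j)
    ≡⟨ cong parity (sum-ordered h) ⟩
  parity (∑[ i < n ] h i i + ∑[ i < n ] ∑[ j < n ] (isLt (ord i j) * (h i j + h j i)))
    ≡⟨ cong (λ d → parity (d + ∑[ i < n ] ∑[ j < n ] (isLt (ord i j) * (h i j + h j i)))) (sum-zero diagonal) ⟩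
  parity (∑[ i < n ] ∑[ j < n ] (isLt (ord i j) * (h i j + h j i)))
    ≡⟨ parity-sum-zero (λ i → parity-sum-zero λ j → even i j) ⟩
  0ℙ ∎
  where
  open ≡-Reasoning
  even : ∀ i j → parity (isLt (ord i j) * (h i j + h j i)) ≡ 0ℙ
  even i j = begin
    parity (isLt (ord i j) * (h i j + h j i))
      ≡⟨ ℙ.*-homo-* (isLt (ord i j)) (h i j + h j i) ⟩
    parity (isLt (ord i j)) ℙ.* parity (h i j + h j i)
      ≡⟨ cong (parity (isLt (ord i j)) ℙ.*_)
           (trans (ℙ.+-homo-+ (h i j) (h j i))
                  (trans (cong (ℙ._+ parity (h j i)) (symmetric i j)) (ℙ.p+p≡0ℙ (parity (h j i))))) ⟩
    parity (isLt (ord i j)) ℙ.* 0ℙ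
      ≡⟨ ℙ.*-zeroʳ (parity (isLt (ord i j))) ⟩
    0ℙ ∎

-- Inversions as pairs of rows

inv : (Fin n → Fin n) → ℕ
inv {n} f = ∑[ y < n ] ∑[ y′ < n ] (isLt (ord y y′) * isGt (ord (f y) (f y′)))

-- Applied to two rows, it tests that they agree in one column and are oppositely ordered by two
-- others. Fixing which of these ascends counts each unordered pair of rows once.
crossing : Order → Order → Order → ℕ
crossing u v w = isEq u * (isLt v * isGt w)

crossings : (γ α β : Fin N → Fin n) → ℕ
crossings {N} γ α β =
  ∑[ r < N ] ∑[ s < N ] crossing (ord (γ r) (γ s)) (ord (α r) (α s)) (ord (β r) (β s))

crossing-flip : ∀ u v w → crossing (flip u) (flip v) (flip w) ≡ crossing u w v
crossing-flip u v w =
  cong₂ _*_ (isEq-flip u) (trans (cong₂ _*_ (isLt-flip v) (isGt-flip w)) (*-comm (isGt v) (isLt w)))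

-- Exchanging the two rows exchanges the roles of `α` and `β`, just as a permutation and its inverse
-- have equally many inversions.
crossings-comm : (γ α β : Fin N → Fin n) → crossings γ α β ≡ crossings γ β α
crossings-comm γ α β =
  trans (∑-comm (λ r s → crossing (ord (γ r) (γ s)) (ord (α r) (α s)) (ord (β r) (β s))))
        (sum-cong₂ pointwise)
  where
  pointwise : ∀ r s → crossing (ord (γ s) (γ r)) (ord (α s) (α r)) (ord (β s) (β r)) ≡
                      crossing (ord (γ r) (γ s)) (ord (β r) (β s)) (ord (α r) (α s))
  pointwise r s rewrite ord-flip (γ r) (γ s) | ord-flip (α r) (α s) | ord-flip (β r) (β s) =
    crossing-flip (ord (γ r) (γ s)) (ord (α r) (α s)) (ord (β r) (β s))

-- The rows with `γ r ≡ x`, listed by their `α`-value, trace the graph of `y ↦ β (ρ x y)`; a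
-- crossing between two of them is an inversion of that map.
crossings-inv :
  (γ α β : Fin N → Fin n) (ρ : Fin n → Fin n → Fin N) →
  (∀ x y → γ (ρ x y) ≡ x) → (∀ x y → α (ρ x y) ≡ y) → (∀ r → ρ (γ r) (α r) ≡ r) →
  crossings γ α β ≡ ∑[ x < n ] inv (λ y → β (ρ x y))
crossings-inv {N} {n} γ α β ρ γρ αρ ργα = begin
  ∑[ r < N ] ∑[ s < N ] c r s
    ≡⟨ reindex (λ r → ∑[ s < N ] c r s) ⟩
  ∑[ x < n ] ∑[ y < n ] ∑[ s < N ] c (ρ x y) s
    ≡⟨ sum-cong₂ (λ x y → reindex (c (ρ x y))) ⟩
  ∑[ x < n ] ∑[ y < n ] ∑[ x′ < n ] ∑[ y′ < n ] c (ρ x y) (ρ x′ y′)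
    ≡⟨ sum-cong₂ (λ x y → sum-cong₂ (λ x′ y′ → coordinates x y x′ y′)) ⟩
  ∑[ x < n ] ∑[ y < n ] ∑[ x′ < n ] ∑[ y′ < n ] (isEq (ord x x′) * d x x′ y y′)
    ≡⟨ sum-cong₂ (λ x y → sum-cong (λ x′ → *-distribˡ-sum (isEq (ord x x′)) (d x x′ y))) ⟨
  ∑[ x < n ] ∑[ y < n ] ∑[ x′ < n ] (isEq (ord x x′) * (∑[ y′ < n ] d x x′ y y′))
    ≡⟨ sum-cong₂ (λ x y → sum-isEq x (λ x′ → ∑[ y′ < n ] d x x′ y y′)) ⟩
  ∑[ x < n ] ∑[ y < n ] ∑[ y′ < n ] d x x y y′ ∎
  where
  open ≡-Reasoning

  reindex : (f : Fin N → ℕ) → sum f ≡ ∑[ x < n ] ∑[ y < n ] f (ρ x y)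
  reindex = sum-reindex γ α ρ γρ αρ ργα

  c : Fin N → Fin N → ℕ
  c r s = crossing (ord (γ r) (γ s)) (ord (α r) (α s)) (ord (β r) (β s))

  d : Fin n → Fin n → Fin n → Fin n → ℕ
  d x x′ y y′ = isLt (ord y y′) * isGt (ord (β (ρ x y)) (β (ρ x′ y′)))

  coordinates : ∀ x y x′ y′ → c (ρ x y) (ρ x′ y′) ≡ isEq (ord x x′) * d x x′ y y′
  coordinates x y x′ y′ rewrite γρ x y | γρ x′ y′ | αρ x y | αρ x′ y′ = refl

-- From counts in lists to sums over `Fin`

listSum-filter : ∀ {P : Pred A _} (P? : Decidable P) xs →
                 List.length (List.filter P? xs) ≡ ListAction.sum (List.map (indicator ∘ P?) xs)
listSum-filter P? []       = refl
listSum-filter P? (x ∷ xs) with does (P? x)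
... | true  = cong suc (listSum-filter P? xs)
... | false = listSum-filter P? xs

listSum-mapMaybe : (f : A → Maybe B) (w : B → ℕ) (xs : List A) →
                   ListAction.sum (List.map w (List.mapMaybe f xs)) ≡
                   ListAction.sum (List.map (λ x → maybe′ w 0 (f x)) xs)
listSum-mapMaybe f w []       = refl
listSum-mapMaybe f w (x ∷ xs) with f x
... | just y  = cong (w y +_) (listSum-mapMaybe f w xs)
... | nothing = listSum-mapMaybe f w xs

listSum-cartesianProduct : (w : A × B → ℕ) (xs : List A) (ys : List B) →
  ListAction.sum (List.map w (List.cartesianProduct xs ys)) ≡
  ListAction.sum (List.map (λ x → ListAction.sum (List.map (λ y → w (x , y)) ys)) xs)
listSum-cartesianProduct w []       ys = refl
listSum-cartesianProduct w (x ∷ xs) ys = begin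
  ListAction.sum (List.map w (List.map (x ,_) ys List.++ List.cartesianProduct xs ys))
    ≡⟨ cong ListAction.sum (List.map-++ w (List.map (x ,_) ys) _) ⟩
  ListAction.sum (List.map w (List.map (x ,_) ys) List.++ List.map w (List.cartesianProduct xs ys))
    ≡⟨ ListAction.sum-++ (List.map w (List.map (x ,_) ys)) _ ⟩
  ListAction.sum (List.map w (List.map (x ,_) ys)) + ListAction.sum (List.map w (List.cartesianProduct xs ys))
    ≡⟨ cong₂ _+_ (cong ListAction.sum (sym (List.map-∘ ys))) (listSum-cartesianProduct w xs ys) ⟩
  ListAction.sum (List.map (λ y → w (x , y)) ys) +
  ListAction.sum (List.map (λ x → ListAction.sum (List.map (λ y → w (x , y)) ys)) xs) ∎
  where open ≡-Reasoning

listSum-tabulate : (w : A → ℕ) (f : Fin n → A) →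
                   ListAction.sum (List.map w (List.tabulate f)) ≡ sum (w ∘ f)
listSum-tabulate {n = zero}  w f = refl
listSum-tabulate {n = suc n} w f = cong (w (f zero) +_) (listSum-tabulate w (f ∘ suc))

indicator-× : ∀ {P Q : Set} (p : Dec P) (q : Dec Q) →
              indicator (p ×-dec q) ≡ indicator p * indicator q
indicator-× p q with does p | does q
... | true  | true  = refl
... | true  | false = refl
... | false | _     = refl

isLt-converse : (i j : Fin n) → isLt (ord j i) ≡ isGt (ord i j)
isLt-converse i j = trans (cong isLt (ord-flip i j)) (isLt-flip (ord i j))

inversions-inv : (π : Permutation′ n) → inversions π ≡ inv (π ⟨$⟩ʳ_)
inversions-inv {n} π = begin
  inversions π
    ≡⟨ listSum-filter inverted? (List.cartesianProduct (List.allFin n) (List.allFin n)) ⟩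
  ListAction.sum (List.map (indicator ∘ inverted?) (List.cartesianProduct (List.allFin n) (List.allFin n)))
    ≡⟨ listSum-cartesianProduct (indicator ∘ inverted?) (List.allFin n) (List.allFin n) ⟩
  ListAction.sum (List.map row (List.allFin n))
    ≡⟨ listSum-tabulate row (λ a → a) ⟩
  ∑[ a < n ] row a
    ≡⟨ sum-cong (λ a → listSum-tabulate (λ b → indicator (inverted? (a , b))) (λ b → b)) ⟩
  ∑[ a < n ] ∑[ b < n ] indicator (inverted? (a , b))
    ≡⟨ sum-cong₂ (λ a b → trans (indicator-× (a <? b) ((π ⟨$⟩ʳ b) <? (π ⟨$⟩ʳ a)))
         (sym (cong₂ _*_ (isLt-indicator a b)
           (trans (sym (isLt-converse (π ⟨$⟩ʳ a) (π ⟨$⟩ʳ b))) (isLt-indicator (π ⟨$⟩ʳ b) (π ⟨$⟩ʳ a)))))) ⟩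
  inv (π ⟨$⟩ʳ_) ∎
  where
  open ≡-Reasoning
  inverted? : Decidable (λ (a , b) → a Fin.< b × (π ⟨$⟩ʳ b) Fin.< (π ⟨$⟩ʳ a))
  inverted? (a , b) = (a <? b) ×-dec ((π ⟨$⟩ʳ b) <? (π ⟨$⟩ʳ a))

  row : Fin n → ℕ
  row a = ListAction.sum (List.map (λ b → indicator (inverted? (a , b))) (List.allFin n))

-- Taking each column of a square in turn as `γ` expresses its row-, column- and symbol-parity by
-- one kind of count over pairs of rows of the array.
sum-permParity :
  (γ α β : Fin N → Fin n) (ρ : Fin n → Fin n → Fin N) →
  (∀ x y → γ (ρ x y) ≡ x) → (∀ x y → α (ρ x y) ≡ y) → (∀ r → ρ (γ r) (α r) ≡ r) →
  (π : Fin n → Permutation′ n) → (∀ x y → π x ⟨$⟩ʳ y ≡ β (ρ x y)) →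
  ℙSum.sum (permParity ∘ π) ≡ parity (crossings γ α β)
sum-permParity {N} {n} γ α β ρ γρ αρ ργα π πβ = begin
  ℙSum.sum (permParity ∘ π)
    ≡⟨ parity-sum (λ x → inversions (π x)) ⟨
  parity (sum (inversions ∘ π))
    ≡⟨ cong parity (sum-cong (λ x → trans (inversions-inv (π x)) (sum-cong₂ λ y y′ →
         cong₂ (λ u v → isLt (ord y y′) * isGt (ord u v)) (πβ x y) (πβ x y′)))) ⟩
  parity (∑[ x < n ] inv (λ y → β (ρ x y)))
    ≡⟨ cong parity (crossings-inv γ α β ρ γρ αρ ργα) ⟨
  parity (crossings γ α β) ∎
  where open ≡-Reasoning

-- Parities of triples of columns

-- This is the uniqueness half of orthogonality; for distinct rows it excludes two comparisons that
-- are `eq` at once.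
Separates : (α β : Fin N → Fin n) → Set
Separates α β = ∀ r s → α r ≡ α s → β r ≡ β s → r ≡ s

-- When `u` is `eq`, the other comparisons are strict, and the two sides together count the
-- disagreeing pairs among `v`, `w`, `z`. Three two-valued items have 0 or 2 such pairs.
crossing-cocycle : ∀ u v w z → (u ≡ eq → v ≢ eq) → (u ≡ eq → w ≢ eq) → (u ≡ eq → z ≢ eq) →
  parity (crossing u v w + crossing u w z + crossing u v z) ≡
  parity (crossing (flip u) (flip v) (flip w) + crossing (flip u) (flip w) (flip z) +
          crossing (flip u) (flip v) (flip z))
crossing-cocycle lt v  w  z  _  _  _  = refl
crossing-cocycle gt v  w  z  _  _  _  = refl
crossing-cocycle eq eq w  z  v≢ _  _  = ⊥-elim (v≢ refl refl)
crossing-cocycle eq lt eq z  _  w≢ _  = ⊥-elim (w≢ refl refl)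
crossing-cocycle eq gt eq z  _  w≢ _  = ⊥-elim (w≢ refl refl)
crossing-cocycle eq lt lt eq _  _  z≢ = ⊥-elim (z≢ refl refl)
crossing-cocycle eq lt gt eq _  _  z≢ = ⊥-elim (z≢ refl refl)
crossing-cocycle eq gt lt eq _  _  z≢ = ⊥-elim (z≢ refl refl)
crossing-cocycle eq gt gt eq _  _  z≢ = ⊥-elim (z≢ refl refl)
crossing-cocycle eq lt lt lt _  _  _  = refl
crossing-cocycle eq lt lt gt _  _  _  = refl
crossing-cocycle eq lt gt lt _  _  _  = refl
crossing-cocycle eq lt gt gt _  _  _  = refl
crossing-cocycle eq gt lt lt _  _  _  = refl
crossing-cocycle eq gt lt gt _  _  _  = refl
crossing-cocycle eq gt gt lt _  _  _  = refl
crossing-cocycle eq gt gt gt _  _  _  = refl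

-- The permutations from `α` to `δ` are composites through `β`, and parity is a homomorphism. In
-- terms of rows, `crossing-cocycle` makes the combined summand of the three counts symmetric modulo
-- 2, so their total is even.
crossings-cocycle :
  (γ α β δ : Fin N → Fin n) → Separates γ α → Separates γ β → Separates γ δ →
  parity (crossings γ α β) ℙ.+ parity (crossings γ β δ) ≡ parity (crossings γ α δ)
crossings-cocycle {N} γ α β δ γα γβ γδ =
  cancel (parity (crossings γ α β)) (parity (crossings γ β δ)) (parity (crossings γ α δ)) (begin
    parity (crossings γ α β) ℙ.+ parity (crossings γ β δ) ℙ.+ parity (crossings γ α δ)
      ≡⟨ cong (ℙ._+ parity (crossings γ α δ)) (ℙ.+-homo-+ (crossings γ α β) (crossings γ β δ)) ⟨
    parity (crossings γ α β + crossings γ β δ) ℙ.+ parity (crossings γ α δ)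
      ≡⟨ ℙ.+-homo-+ (crossings γ α β + crossings γ β δ) (crossings γ α δ) ⟨
    parity (crossings γ α β + crossings γ β δ + crossings γ α δ)
      ≡⟨ cong parity (trans (cong (_+ crossings γ α δ) (sym (sum-distrib₂ (x γ α β) (x γ β δ))))
                            (sym (sum-distrib₂ (λ r s → x γ α β r s + x γ β δ r s) (x γ α δ)))) ⟩
    parity (∑[ r < N ] ∑[ s < N ] h r s)
      ≡⟨ parity-symmetric h diagonal symmetric ⟩
    0ℙ ∎)
  where
  open ≡-Reasoning

  cancel : ∀ p q r → p ℙ.+ q ℙ.+ r ≡ 0ℙ → p ℙ.+ q ≡ r
  cancel p q r e = ℙ.+-cancelʳ-≡ r (p ℙ.+ q) r (trans e (sym (ℙ.p+p≡0ℙ r)))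

  x : (ζ η θ : Fin _ → Fin _) → Fin _ → Fin _ → ℕ
  x ζ η θ r s = crossing (ord (ζ r) (ζ s)) (ord (η r) (η s)) (ord (θ r) (θ s))

  h : Fin _ → Fin _ → ℕ
  h r s = x γ α β r s + x γ β δ r s + x γ α δ r s

  diagonal : ∀ r → h r r ≡ 0
  diagonal r rewrite ord-refl (γ r) | ord-refl (α r) | ord-refl (β r) = refl

  symmetric : ∀ r s → parity (h r s) ≡ parity (h s r)
  symmetric r s with r ≟ s
  ... | yes refl = refl
  ... | no r≢s rewrite ord-flip (γ r) (γ s) | ord-flip (α r) (α s) | ord-flip (β r) (β s) | ord-flip (δ r) (δ s) =
    crossing-cocycle (ord (γ r) (γ s)) (ord (α r) (α s)) (ord (β r) (β s)) (ord (δ r) (δ s))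
      (distinct α γα) (distinct β γβ) (distinct δ γδ)
    where
    distinct : ∀ η → Separates γ η → ord (γ r) (γ s) ≡ eq → ord (η r) (η s) ≢ eq
    distinct η γη e e′ = r≢s (γη r s (ord-eq _ _ e) (ord-eq _ _ e′))

-- Oppositely ordered pairs of rows

swaps : (α β : Fin N → Fin n) → ℕ
swaps {N} α β = ∑[ r < N ] ∑[ s < N ] (isLt (ord (α r) (α s)) * isGt (ord (β r) (β s)))

-- This is `n C 2`, in the form in which it arises from sums over `Fin n`.
ascents : ℕ → ℕ
ascents n = ∑[ x < n ] ∑[ y < n ] isLt (ord x y)

-- Rows correspond to all pairs of values, so an ascent in `α` and a descent in `β` are chosen
-- independently.
swaps-ascents :
  (α β : Fin N → Fin n) (ρ : Fin n → Fin n → Fin N) →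
  (∀ x y → α (ρ x y) ≡ x) → (∀ x y → β (ρ x y) ≡ y) → (∀ r → ρ (α r) (β r) ≡ r) →
  swaps α β ≡ ascents n * ascents n
swaps-ascents {N} {n} α β ρ αρ βρ ραβ = begin
  ∑[ r < N ] ∑[ s < N ] c r s
    ≡⟨ reindex (λ r → ∑[ s < N ] c r s) ⟩
  ∑[ x < n ] ∑[ y < n ] ∑[ s < N ] c (ρ x y) s
    ≡⟨ sum-cong₂ (λ x y → trans (reindex (c (ρ x y))) (sum-cong₂ (coordinates x y))) ⟩
  ∑[ x < n ] ∑[ y < n ] ∑[ x′ < n ] ∑[ y′ < n ] (isLt (ord x x′) * isGt (ord y y′))
    ≡⟨ sum-cong₂ (λ (x y : Fin n) → sum-product (isLt ∘ ord x) (isGt ∘ ord y)) ⟨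
  ∑[ x < n ] ∑[ y < n ] (sum (isLt ∘ ord x) * sum (isGt ∘ ord y))
    ≡⟨ sum-product (λ (x : Fin n) → sum (isLt ∘ ord x)) (λ (y : Fin n) → sum (isGt ∘ ord y)) ⟨
  ascents n * (∑[ y < n ] ∑[ y′ < n ] isGt (ord y y′))
    ≡⟨ cong (ascents n *_) (trans (∑-comm (λ (y y′ : Fin n) → isGt (ord y y′)))
         (sum-cong₂ λ (y y′ : Fin n) → trans (cong isGt (ord-flip y y′)) (isGt-flip (ord y y′)))) ⟩
  ascents n * ascents n ∎
  where
  open ≡-Reasoning

  reindex : (f : Fin N → ℕ) → sum f ≡ ∑[ x < n ] ∑[ y < n ] f (ρ x y)
  reindex = sum-reindex α β ρ αρ βρ ραβ

  c : Fin N → Fin N → ℕ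
  c r s = isLt (ord (α r) (α s)) * isGt (ord (β r) (β s))

  coordinates : ∀ x y x′ y′ → c (ρ x y) (ρ x′ y′) ≡ isLt (ord x x′) * isGt (ord y y′)
  coordinates x y x′ y′ rewrite αρ x y | αρ x′ y′ | βρ x y | βρ x′ y′ = refl

sum-one : ∀ n → ∑[ i < n ] 1 ≡ n
sum-one zero    = refl
sum-one (suc n) = cong suc (sum-one n)

ascents-suc : ∀ n → ascents (suc n) ≡ n + ascents n
ascents-suc n = cong (_+ ascents n) (sum-one n)

-- The four increments from `n` to `3 + n` have an even sum, so the parity of `n C 2` has period 4.
parity-ascents-4+ : ∀ n → parity (ascents (4 + n)) ≡ parity (ascents n)
parity-ascents-4+ n = begin
  parity (ascents (4 + n))
    ≡⟨ cong parity (ascents-suc (3 + n)) ⟩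
  parity (3 + n + ascents (3 + n))
    ≡⟨ cong (λ a → parity (3 + n + a)) (ascents-suc (2 + n)) ⟩
  parity (3 + n + (2 + n + ascents (2 + n)))
    ≡⟨ cong (λ a → parity (3 + n + (2 + n + a))) (ascents-suc (1 + n)) ⟩
  parity (3 + n + (2 + n + (1 + n + ascents (1 + n))))
    ≡⟨ cong (λ a → parity (3 + n + (2 + n + (1 + n + a)))) (ascents-suc n) ⟩
  parity (3 + n + (2 + n + (1 + n + (n + ascents n))))
    ≡⟨ cong parity (rearrange n (ascents n)) ⟩
  parity (2 * (3 + 2 * n) + ascents n)
    ≡⟨ ℙ.+-homo-+ (2 * (3 + 2 * n)) (ascents n) ⟩
  parity (2 * (3 + 2 * n)) ℙ.+ parity (ascents n)
    ≡⟨ cong (ℙ._+ parity (ascents n)) (parity-2* (3 + 2 * n)) ⟩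
  parity (ascents n) ∎
  where
  open ≡-Reasoning
  rearrange : ∀ n a → 3 + n + (2 + n + (1 + n + (n + a))) ≡ 2 * (3 + 2 * n) + a
  rearrange = solve-∀

-- The residue of `n` does its work here: `n C 2` is 1 at 2 and 3 at 3, and the period carries
-- oddness further.
parity-ascents : ∀ n → n % 4 ≡ 2 ⊎ n % 4 ≡ 3 → parity (ascents n) ≡ 1ℙ
parity-ascents 0 (inj₁ ())
parity-ascents 0 (inj₂ ())
parity-ascents 1 (inj₁ ())
parity-ascents 1 (inj₂ ())
parity-ascents 2 _ = refl
parity-ascents 3 _ = refl
parity-ascents (suc (suc (suc (suc n)))) e =
  trans (parity-ascents-4+ n) (parity-ascents n (subst (λ r → r ≡ 2 ⊎ r ≡ 3) periodic e))
  where
  periodic : (4 + n) % 4 ≡ n % 4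
  periodic = trans (cong (_% 4) (+-comm 4 n)) ([m+n]%n≡m%n n 4)

swapping : Order → Order → ℕ
swapping u v = isLt u * isGt v

-- If u, v, w are all strict, the crossings vanish and an even number of the
-- unordered disagreements remains; if just one of them is eq, the crossing that
-- tests it cancels modulo 2 against the swapping of the other two.
crossing-swapping : Order → Order → Order → ℕ
crossing-swapping u v w =
  (crossing u v w + crossing v u w + crossing w u v) + (swapping u v + swapping v w + swapping u w)

crossing-swapping-flip : ∀ u v w → (u ≡ eq → v ≢ eq) → (v ≡ eq → w ≢ eq) → (u ≡ eq → w ≢ eq) →
  parity (crossing-swapping u v w) ≡ parity (crossing-swapping (flip u) (flip v) (flip w))
crossing-swapping-flip eq eq w  uv _  _  = ⊥-elim (uv refl refl)
crossing-swapping-flip eq v  eq _  _  uw = ⊥-elim (uw refl refl)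
crossing-swapping-flip u  eq eq _  vw _  = ⊥-elim (vw refl refl)
crossing-swapping-flip eq lt lt _  _  _  = refl
crossing-swapping-flip eq lt gt _  _  _  = refl
crossing-swapping-flip eq gt lt _  _  _  = refl
crossing-swapping-flip eq gt gt _  _  _  = refl
crossing-swapping-flip lt eq lt _  _  _  = refl
crossing-swapping-flip lt eq gt _  _  _  = refl
crossing-swapping-flip gt eq lt _  _  _  = refl
crossing-swapping-flip gt eq gt _  _  _  = refl
crossing-swapping-flip lt lt eq _  _  _  = refl
crossing-swapping-flip lt gt eq _  _  _  = refl
crossing-swapping-flip gt lt eq _  _  _  = refl
crossing-swapping-flip gt gt eq _  _  _  = refl
crossing-swapping-flip lt lt lt _  _  _  = refl
crossing-swapping-flip lt lt gt _  _  _  = refl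
crossing-swapping-flip lt gt lt _  _  _  = refl
crossing-swapping-flip lt gt gt _  _  _  = refl
crossing-swapping-flip gt lt lt _  _  _  = refl
crossing-swapping-flip gt lt gt _  _  _  = refl
crossing-swapping-flip gt gt lt _  _  _  = refl
crossing-swapping-flip gt gt gt _  _  _  = refl

-- This underlies the relation among the row-, column- and symbol-parity of a square. Both sides
-- together sum `crossing-swapping` over pairs of rows, and by `crossing-swapping-flip` the terms at
-- `(r , s)` and `(s , r)` cancel.
parity-crossings-swaps :
  (α β γ : Fin N → Fin n) → Separates α β → Separates β γ → Separates α γ →
  parity (crossings α β γ + crossings β α γ + crossings γ α β) ≡
  parity (swaps α β + swaps β γ + swaps α γ)
parity-crossings-swaps {N} α β γ αβ βγ αγ = cancel (parity X) (parity Y) (begin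
  parity X ℙ.+ parity Y
    ≡⟨ ℙ.+-homo-+ X Y ⟨
  parity (X + Y)
    ≡⟨ cong parity (sym split) ⟩
  parity (∑[ r < N ] ∑[ s < N ] h r s)
    ≡⟨ parity-symmetric h diagonal symmetric ⟩
  0ℙ ∎)
  where
  open ≡-Reasoning

  cancel : ∀ p q → p ℙ.+ q ≡ 0ℙ → p ≡ q
  cancel p q e = ℙ.+-cancelʳ-≡ q p q (trans e (sym (ℙ.p+p≡0ℙ q)))

  X Y : ℕ
  X = crossings α β γ + crossings β α γ + crossings γ α β
  Y = swaps α β + swaps β γ + swaps α γ

  x : (ζ η θ : Fin _ → Fin _) → Fin _ → Fin _ → ℕ
  x ζ η θ r s = crossing (ord (ζ r) (ζ s)) (ord (η r) (η s)) (ord (θ r) (θ s))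

  y : (ζ η : Fin _ → Fin _) → Fin _ → Fin _ → ℕ
  y ζ η r s = swapping (ord (ζ r) (ζ s)) (ord (η r) (η s))

  h : Fin _ → Fin _ → ℕ
  h r s = crossing-swapping (ord (α r) (α s)) (ord (β r) (β s)) (ord (γ r) (γ s))

  split₃ : ∀ (f g k : Fin N → Fin N → ℕ) →
           ∑[ r < N ] ∑[ s < N ] (f r s + g r s + k r s) ≡
           ∑[ r < N ] ∑[ s < N ] f r s + ∑[ r < N ] ∑[ s < N ] g r s + ∑[ r < N ] ∑[ s < N ] k r s
  split₃ f g k = trans (sum-distrib₂ (λ r s → f r s + g r s) k)
                       (cong (_+ ∑[ r < N ] ∑[ s < N ] k r s) (sum-distrib₂ f g))

  split : ∑[ r < N ] ∑[ s < N ] h r s ≡ X + Y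
  split = trans
    (sum-distrib₂ (λ r s → x α β γ r s + x β α γ r s + x γ α β r s)
                  (λ r s → y α β r s + y β γ r s + y α γ r s))
    (cong₂ _+_ (split₃ (x α β γ) (x β α γ) (x γ α β)) (split₃ (y α β) (y β γ) (y α γ)))

  diagonal : ∀ r → h r r ≡ 0
  diagonal r rewrite ord-refl (γ r) | ord-refl (α r) | ord-refl (β r) = refl

  symmetric : ∀ r s → parity (h r s) ≡ parity (h s r)
  symmetric r s with r ≟ s
  ... | yes refl = refl
  ... | no r≢s rewrite ord-flip (α r) (α s) | ord-flip (β r) (β s) | ord-flip (γ r) (γ s) =
    crossing-swapping-flip (ord (α r) (α s)) (ord (β r) (β s)) (ord (γ r) (γ s))
      (distinct α β αβ) (distinct β γ βγ) (distinct α γ αγ)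
    where
    distinct : ∀ ζ η → Separates ζ η → ord (ζ r) (ζ s) ≡ eq → ord (η r) (η s) ≢ eq
    distinct ζ η ζη e e′ = r≢s (ζη r s (ord-eq _ _ e) (ord-eq _ _ e′))

-- Counting cuts and triples

bit : Parity → ℕ
bit 0ℙ = 0
bit 1ℙ = 1

-- The gap is the square of the difference; writing the larger number as the smaller plus `d` makes
-- it `d * d` without subtraction.
4xy≤[x+y]² : ∀ x y → 4 * (x * y) ≤ (x + y) * (x + y)
4xy≤[x+y]² x y with ≤-total x y
... | inj₁ x≤y with d , refl ← m≤n⇒∃[o]m+o≡n x≤y =
  subst (4 * (x * (x + d)) ≤_) (complete x d) (m≤m+n (4 * (x * (x + d))) (d * d))
  where
  complete : ∀ x d → 4 * (x * (x + d)) + d * d ≡ (x + (x + d)) * (x + (x + d))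
  complete = solve-∀
... | inj₂ y≤x with d , refl ← m≤n⇒∃[o]m+o≡n y≤x =
  subst (4 * ((y + d) * y) ≤_) (complete y d) (m≤m+n (4 * ((y + d) * y)) (d * d))
  where
  complete : ∀ y d → 4 * ((y + d) * y) + d * d ≡ (y + d + y) * (y + d + y)
  complete = solve-∀

-- `f` colours the indices with two colours. The bichromatic pairs form a complete bipartite graph,
-- whose weight is the product of the weights of the two colour classes.
cut-bound : (w : Fin k → ℕ) (f : Fin k → Parity) →
  4 * (∑[ a < k ] ∑[ b < k ] (isLt (ord a b) * (w a * w b * bit (f a ℙ.+ f b)))) ≤ sum w * sum w
cut-bound {k} w f = begin
  4 * (∑[ a < k ] ∑[ b < k ] (isLt (ord a b) * (w a * w b * bit (f a ℙ.+ f b))))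
    ≡⟨ cong (4 *_) (sym cut) ⟩
  4 * (sum x * sum y)
    ≤⟨ 4xy≤[x+y]² (sum x) (sum y) ⟩
  (sum x + sum y) * (sum x + sum y)
    ≡⟨ cong₂ _*_ total total ⟩
  sum w * sum w ∎
  where
  open ≤-Reasoning

  x y : Fin k → ℕ
  x a = w a * bit (f a)
  y a = w a * bit (f a ℙ.⁻¹)

  total : sum x + sum y ≡ sum w
  total = trans (sym (∑-distrib-+ x y)) (sum-cong λ a → pointwise (w a) (f a))
    where
    pointwise : ∀ m p → m * bit p + m * bit (p ℙ.⁻¹) ≡ m
    pointwise m 0ℙ rewrite *-zeroʳ m = *-identityʳ m
    pointwise m 1ℙ rewrite *-zeroʳ m = trans (+-identityʳ _) (*-identityʳ m)

  -- An index lies in one class only, so the diagonal vanishes; the two products for a pair `a < b`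
  -- together give `w a * w b` if the colours differ and 0 otherwise.
  cut : sum x * sum y ≡ ∑[ a < k ] ∑[ b < k ] (isLt (ord a b) * (w a * w b * bit (f a ℙ.+ f b)))
  cut = trans (sum-product x y) (trans (sum-ordered (λ a b → x a * y b))
    (cong₂ _+_ (sum-zero λ a → diagonal (w a) (f a))
               (sum-cong₂ λ a b → cong (isLt (ord a b) *_) (off-diagonal (w a) (w b) (f a) (f b)))))
    where
    diagonal : ∀ m p → m * bit p * (m * bit (p ℙ.⁻¹)) ≡ 0
    diagonal m 0ℙ rewrite *-zeroʳ m = refl
    diagonal m 1ℙ rewrite *-zeroʳ m = *-zeroʳ (m * 1)

    off-diagonal : ∀ l m p q →
      l * bit p * (m * bit (q ℙ.⁻¹)) + m * bit q * (l * bit (p ℙ.⁻¹)) ≡ l * m * bit (p ℙ.+ q)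
    off-diagonal l m 0ℙ 0ℙ = identity l m
      where
      identity : ∀ l m → l * 0 * (m * 1) + m * 0 * (l * 1) ≡ l * m * 0
      identity = solve-∀
    off-diagonal l m 0ℙ 1ℙ = identity l m
      where
      identity : ∀ l m → l * 0 * (m * 0) + m * 1 * (l * 1) ≡ l * m * 1
      identity = solve-∀
    off-diagonal l m 1ℙ 0ℙ = identity l m
      where
      identity : ∀ l m → l * 1 * (m * 1) + m * 0 * (l * 0) ≡ l * m * 1
      identity = solve-∀
    off-diagonal l m 1ℙ 1ℙ = identity l m
      where
      identity : ∀ l m → l * 1 * (m * 0) + m * 1 * (l * 0) ≡ l * m * 0
      identity = solve-∀

-- Idempotent weights are 0 or 1, and this is `m² = m + 2 (m C 2)` for the `m` selected indices.
sum-square : (w : Fin k → ℕ) → (∀ a → w a * w a ≡ w a) →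
  sum w * sum w ≡ sum w + 2 * (∑[ a < k ] ∑[ b < k ] (isLt (ord a b) * (w a * w b)))
sum-square {k} w idempotent = begin
  sum w * sum w
    ≡⟨ trans (sum-product w w) (sum-ordered (λ a b → w a * w b)) ⟩
  ∑[ a < k ] (w a * w a) + ∑[ a < k ] ∑[ b < k ] (isLt (ord a b) * (w a * w b + w b * w a))
    ≡⟨ cong₂ _+_ (sum-cong idempotent) (sum-cong₂ λ a b → double (isLt (ord a b)) (w a) (w b)) ⟩
  sum w + ∑[ a < k ] ∑[ b < k ] (2 * (isLt (ord a b) * (w a * w b)))
    ≡⟨ cong (sum w +_) (trans (*-distribˡ-sum 2 (λ a → ∑[ b < k ] (isLt (ord a b) * (w a * w b))))
         (sum-cong λ a → *-distribˡ-sum 2 (λ b → isLt (ord a b) * (w a * w b)))) ⟨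
  sum w + 2 * (∑[ a < k ] ∑[ b < k ] (isLt (ord a b) * (w a * w b))) ∎
  where
  open ≡-Reasoning
  double : ∀ o x y → o * (x * y + y * x) ≡ 2 * (o * (x * y))
  double = solve-∀

sum-isNe : (c : Fin (suc k)) → ∑[ a < suc k ] isNe (ord c a) ≡ k
sum-isNe {k}     zero    = sum-one k
sum-isNe {suc k} (suc c) = cong suc (sum-isNe c)

-- A third index c falls below, between or above a < b.
isLt-insert : (c a b : Fin k) →
  isLt (ord a b) * (isNe (ord c a) * isNe (ord c b)) ≡
  isLt (ord c a) * isLt (ord a b) + isLt (ord a c) * isLt (ord c b) + isLt (ord a b) * isLt (ord b c)
isLt-insert zero    zero    zero    = refl
isLt-insert zero    zero    (suc b) = refl
isLt-insert zero    (suc a) zero    = refl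
isLt-insert zero    (suc a) (suc b) = shuffle (isLt (ord a b))
  where
  shuffle : ∀ o → o * 1 ≡ 1 * o + 0 + o * 0
  shuffle = solve-∀
isLt-insert (suc c) zero    zero    = refl
isLt-insert (suc c) zero    (suc b) rewrite ord-flip c b with ord c b
... | lt = refl
... | eq = refl
... | gt = refl
isLt-insert (suc c) (suc a) zero    rewrite *-zeroʳ (isLt (ord c a)) | *-zeroʳ (isLt (ord a c)) = refl
isLt-insert (suc c) (suc a) (suc b) = isLt-insert c a b

-- An index `c` with a pair `a < b` of other indices is an increasing triple with one marked member,
-- the lowest, middle or highest. This converts counts by column into counts by square.
sum-triples : (g : Fin k → Fin k → Fin k → ℕ) →
  ∑[ c < k ] ∑[ a < k ] ∑[ b < k ] (isLt (ord a b) * (isNe (ord c a) * isNe (ord c b) * g c a b)) ≡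
  ∑[ i < k ] ∑[ j < k ] ∑[ l < k ] (isLt (ord i j) * isLt (ord j l) * (g i j l + g j i l + g l i j))
sum-triples {k} g = begin
  ∑[ c < k ] ∑[ a < k ] ∑[ b < k ] (isLt (ord a b) * (isNe (ord c a) * isNe (ord c b) * g c a b))
    ≡⟨ sum-cong (λ c → sum-cong₂ (λ a b → split c a b)) ⟩
  ∑[ c < k ] ∑[ a < k ] ∑[ b < k ] (x c a b + y c a b + z c a b)
    ≡⟨ sum-cong (λ c → sum-split (x c) (y c) (z c)) ⟩
  ∑[ c < k ] (∑₂ (x c) + ∑₂ (y c) + ∑₂ (z c))
    ≡⟨ trans (∑-distrib-+ (λ c → ∑₂ (x c) + ∑₂ (y c)) (λ c → ∑₂ (z c)))
             (cong (_+ ∑[ c < k ] ∑₂ (z c)) (∑-distrib-+ (λ c → ∑₂ (x c)) (λ c → ∑₂ (y c)))) ⟩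
  ∑[ c < k ] ∑₂ (x c) + ∑[ c < k ] ∑₂ (y c) + ∑[ c < k ] ∑₂ (z c)
    -- The variables are renamed to `i`, `j`, `l`: `c` becomes the middle index in `y` and the last
    -- in `z`.
    ≡⟨ cong₂ (λ u v → ∑[ c < k ] ∑₂ (x c) + u + v)
         (∑-comm (λ c a → ∑[ b < k ] y c a b))
         (trans (∑-comm (λ c a → ∑[ b < k ] z c a b)) (sum-cong λ a → ∑-comm (λ c b → z c a b))) ⟩
  ∑[ i < k ] ∑₂ (x i) + ∑[ i < k ] ∑₂ (λ j l → y j i l) + ∑[ i < k ] ∑₂ (λ j l → z l i j)
    ≡⟨ trans (∑-distrib-+ (λ i → ∑₂ (x i) + ∑₂ (λ j l → y j i l)) (λ i → ∑₂ (λ j l → z l i j)))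
             (cong (_+ ∑[ i < k ] ∑₂ (λ j l → z l i j))
                   (∑-distrib-+ (λ i → ∑₂ (x i)) (λ i → ∑₂ (λ j l → y j i l)))) ⟨
  ∑[ i < k ] (∑₂ (x i) + ∑₂ (λ j l → y j i l) + ∑₂ (λ j l → z l i j))
    ≡⟨ sum-cong (λ i → sum-split (x i) (λ j l → y j i l) (λ j l → z l i j)) ⟨
  ∑[ i < k ] ∑[ j < k ] ∑[ l < k ] (x i j l + y j i l + z l i j)
    ≡⟨ sum-cong (λ i → sum-cong₂ (λ j l → factor (isLt (ord i j) * isLt (ord j l)) (g i j l) (g j i l) (g l i j))) ⟩
  ∑[ i < k ] ∑[ j < k ] ∑[ l < k ] (isLt (ord i j) * isLt (ord j l) * (g i j l + g j i l + g l i j)) ∎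
  where
  open ≡-Reasoning

  ∑₂ : (Fin k → Fin k → ℕ) → ℕ
  ∑₂ f = ∑[ a < k ] ∑[ b < k ] f a b

  x y z : Fin k → Fin k → Fin k → ℕ
  x c a b = isLt (ord c a) * isLt (ord a b) * g c a b
  y c a b = isLt (ord a c) * isLt (ord c b) * g c a b
  z c a b = isLt (ord a b) * isLt (ord b c) * g c a b

  sum-split : ∀ f f′ f″ → ∑₂ (λ a b → f a b + f′ a b + f″ a b) ≡ ∑₂ f + ∑₂ f′ + ∑₂ f″
  sum-split f f′ f″ = trans (sum-distrib₂ (λ a b → f a b + f′ a b) f″) (cong (_+ ∑₂ f″) (sum-distrib₂ f f′))

  factor : ∀ o u v w → o * u + o * v + o * w ≡ o * (u + v + w)
  factor = solve-∀

  split : ∀ c a b → isLt (ord a b) * (isNe (ord c a) * isNe (ord c b) * g c a b) ≡ x c a b + y c a b + z c a b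
  split c a b = begin
    isLt (ord a b) * (isNe (ord c a) * isNe (ord c b) * g c a b)
      ≡⟨ *-assoc (isLt (ord a b)) (isNe (ord c a) * isNe (ord c b)) (g c a b) ⟨
    isLt (ord a b) * (isNe (ord c a) * isNe (ord c b)) * g c a b
      ≡⟨ cong (_* g c a b) (isLt-insert c a b) ⟩
    (isLt (ord c a) * isLt (ord a b) + isLt (ord a c) * isLt (ord c b) + isLt (ord a b) * isLt (ord b c)) * g c a b
      ≡⟨ distrib (isLt (ord c a) * isLt (ord a b)) (isLt (ord a c) * isLt (ord c b))
                 (isLt (ord a b) * isLt (ord b c)) (g c a b) ⟩
    x c a b + y c a b + z c a b ∎
    where
    distrib : ∀ u v w m → (u + v + w) * m ≡ u * m + v * m + w * m
    distrib = solve-∀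

-- Uniform bounds and binomial coefficients

sum-const : (f : Fin k → ℕ) (m : ℕ) → (∀ i → f i ≡ m) → sum f ≡ k * m
sum-const {zero}  f m e = refl
sum-const {suc k} f m e = cong₂ _+_ (e zero) (sum-const (f ∘ suc) m (e ∘ suc))

sum-bound : (f : Fin k → ℕ) (m : ℕ) → (∀ i → f i ≤ m) → sum f ≤ k * m
sum-bound {zero}  f m b = z≤n
sum-bound {suc k} f m b = +-mono-≤ (b zero) (sum-bound (f ∘ suc) m (b ∘ suc))

2*C2 : ∀ m → 2 * (suc m C 2) ≡ suc m * m
2*C2 zero    = refl
2*C2 (suc m) = begin
  2 * (suc (suc m) C 2)
    ≡⟨ cong (2 *_) (sym (nCk+nC[k+1]≡[n+1]C[k+1] (suc m) 1)) ⟩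
  2 * (suc m C 1 + suc m C 2)
    ≡⟨ cong (λ c → 2 * (c + suc m C 2)) (nC1≡n (suc m)) ⟩
  2 * (suc m + suc m C 2)
    ≡⟨ *-distribˡ-+ 2 (suc m) (suc m C 2) ⟩
  2 * suc m + 2 * (suc m C 2)
    ≡⟨ cong (2 * suc m +_) (2*C2 m) ⟩
  2 * suc m + suc m * m
    ≡⟨ collect m ⟩
  suc (suc m) * suc m ∎
  where
  open ≡-Reasoning
  collect : ∀ m → 2 * suc m + suc m * m ≡ suc (suc m) * suc m
  collect = solve-∀

-- Here `d` stands for `k − 2`, which keeps truncated subtraction out; Pascal's rule gives the
-- induction.
6*C3 : ∀ d → 6 * (suc (suc d) C 3) ≡ suc (suc d) * suc d * d
6*C3 zero    = refl
6*C3 (suc d) = begin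
  6 * (suc (suc (suc d)) C 3)
    ≡⟨ cong (6 *_) (sym (nCk+nC[k+1]≡[n+1]C[k+1] (suc (suc d)) 2)) ⟩
  6 * (suc (suc d) C 2 + suc (suc d) C 3)
    ≡⟨ expand (suc (suc d) C 2) (suc (suc d) C 3) ⟩
  3 * (2 * (suc (suc d) C 2)) + 6 * (suc (suc d) C 3)
    ≡⟨ cong₂ (λ u v → 3 * u + v) (2*C2 (suc d)) (6*C3 d) ⟩
  3 * (suc (suc d) * suc d) + suc (suc d) * suc d * d
    ≡⟨ collect d ⟩
  suc (suc (suc d)) * suc (suc d) * suc d ∎
  where
  open ≡-Reasoning
  expand : ∀ u v → 6 * (u + v) ≡ 3 * (2 * u) + 6 * v
  expand = solve-∀
  collect : ∀ d → 3 * (suc (suc d) * suc d) + suc (suc d) * suc d * d ≡ suc (suc (suc d)) * suc (suc d) * suc d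
  collect = solve-∀

-- Orthogonal arrays

module _ (A : OA k n) where

  column : Fin k → Fin (n ^ 2) → Fin n
  column j r = array A r j

  -- The parity, summed over the symbols x of column c, of the permutations that
  -- column a induces on column b along the rows having x in column c.
  pairParity : Fin k → Fin k → Fin k → Parity
  pairParity c a b = parity (crossings (column c) (column a) (column b))

  column-separates : ∀ {i j} → i ≢ j → Separates (column i) (column j)
  column-separates i≢j r s e e′ =
    trans (sym (rowAt-unique A i≢j e e′)) (rowAt-unique A i≢j refl refl)

  rowAt-column : ∀ {i j} (i≢j : i ≢ j) r → rowAt A i≢j (column i r) (column j r) ≡ r
  rowAt-column i≢j r = rowAt-unique A i≢j refl refl

  pairParity-comm : ∀ c a b → pairParity c a b ≡ pairParity c b a
  pairParity-comm c a b = cong parity (crossings-comm (column c) (column a) (column b))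

  pairParity-cocycle : ∀ {c a b d} → c ≢ a → c ≢ b → c ≢ d →
                       pairParity c a b ℙ.+ pairParity c b d ≡ pairParity c a d
  pairParity-cocycle c≢a c≢b c≢d = crossings-cocycle _ _ _ _
    (column-separates c≢a) (column-separates c≢b) (column-separates c≢d)

  swaps-column : ∀ {i j} → i ≢ j → swaps (column i) (column j) ≡ ascents n * ascents n
  swaps-column {i} {j} i≢j = swaps-ascents (column i) (column j) (rowAt A i≢j)
    (rowAt-fst A i≢j) (rowAt-snd A i≢j) (rowAt-column i≢j)

  -- By `parity-crossings-swaps` the sum has the parity of three terms `(n C 2)²`, one for each pair
  -- of columns, and each is odd.
  pairParity-sum : n % 4 ≡ 2 ⊎ n % 4 ≡ 3 → ∀ {i j ℓ} → i ≢ j → j ≢ ℓ → i ≢ ℓ →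
                   pairParity i j ℓ ℙ.+ pairParity j i ℓ ℙ.+ pairParity ℓ i j ≡ 1ℙ
  pairParity-sum n%4 {i} {j} {ℓ} i≢j j≢ℓ i≢ℓ = begin
    pairParity i j ℓ ℙ.+ pairParity j i ℓ ℙ.+ pairParity ℓ i j
      ≡⟨ parity-+₃ (crossings (column i) (column j) (column ℓ)) (crossings (column j) (column i) (column ℓ))
                   (crossings (column ℓ) (column i) (column j)) ⟨
    parity (crossings (column i) (column j) (column ℓ) + crossings (column j) (column i) (column ℓ) +
            crossings (column ℓ) (column i) (column j))
      ≡⟨ parity-crossings-swaps (column i) (column j) (column ℓ)
           (column-separates i≢j) (column-separates j≢ℓ) (column-separates i≢ℓ) ⟩
    parity (swaps (column i) (column j) + swaps (column j) (column ℓ) + swaps (column i) (column ℓ))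
      ≡⟨ parity-+₃ (swaps (column i) (column j)) (swaps (column j) (column ℓ)) (swaps (column i) (column ℓ)) ⟩
    parity (swaps (column i) (column j)) ℙ.+ parity (swaps (column j) (column ℓ)) ℙ.+
    parity (swaps (column i) (column ℓ))
      ≡⟨ cong₂ ℙ._+_ (cong₂ ℙ._+_ (odd i≢j) (odd j≢ℓ)) (odd i≢ℓ) ⟩
    1ℙ ∎
    where
    open ≡-Reasoning

    parity-+₃ : ∀ x y z → parity (x + y + z) ≡ parity x ℙ.+ parity y ℙ.+ parity z
    parity-+₃ x y z = trans (ℙ.+-homo-+ (x + y) z) (cong (ℙ._+ parity z) (ℙ.+-homo-+ x y))

    odd : ∀ {i j} → i ≢ j → parity (swaps (column i) (column j)) ≡ 1ℙ
    odd i≢j rewrite swaps-column i≢j | ℙ.*-homo-* (ascents n) (ascents n) | parity-ascents n n%4 = refl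

  module _ {i j ℓ : Fin k} (i<j : i Fin.< j) (j<ℓ : j Fin.< ℓ) where

    private
      i≢j : i ≢ j
      i≢j = Fin.<⇒≢ i<j
      j≢ℓ : j ≢ ℓ
      j≢ℓ = Fin.<⇒≢ j<ℓ
      i≢ℓ : i ≢ ℓ
      i≢ℓ = Fin.<⇒≢ (Fin.<-trans i<j j<ℓ)
      L : LatinSquare n
      L = square A i<j j<ℓ

    -- Each of the three parities fixes one column and reads a second against a third, so
    -- `sum-permParity` applies with the fixed column as `γ`.
    rowParity-square : rowParity L ≡ pairParity i j ℓ
    rowParity-square = sum-permParity (column i) (column j) (column ℓ) (rowAt A i≢j)
      (rowAt-fst A i≢j) (rowAt-snd A i≢j) (rowAt-column i≢j) (rowPerm L) (λ x y → refl)

    columnParity-square : columnParity L ≡ pairParity j i ℓ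
    columnParity-square = sum-permParity (column j) (column i) (column ℓ) (λ y x → rowAt A i≢j x y)
      (λ y x → rowAt-snd A i≢j x y) (λ y x → rowAt-fst A i≢j x y) (rowAt-column i≢j)
      (columnPerm L) (λ y x → refl)

    -- `symbolPerm` takes its values from `inRow`, that is, from the row of the array located by
    -- columns `i` and `ℓ`; hence `rowAt A i≢ℓ`.
    symbolParity-square : symbolParity L ≡ pairParity ℓ i j
    symbolParity-square = sum-permParity (column ℓ) (column i) (column j) (λ s x → rowAt A i≢ℓ x s)
      (λ s x → rowAt-snd A i≢ℓ x s) (λ s x → rowAt-fst A i≢ℓ x s) (rowAt-column i≢ℓ)
      (symbolPerm L) (λ s x → refl)

  -- The default 0 at triples that are not increasing lets the count over `triples k` become an
  -- unrestricted triple sum.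
  isEquiparity : Fin k → Fin k → Fin k → ℕ
  isEquiparity i j ℓ =
    maybe′ (λ (triple p q) → indicator (equiparity? (square A p q))) 0 (toTriple (i , j , ℓ))

  equiparityCount-sum : equiparityCount A ≡ ∑[ i < k ] ∑[ j < k ] ∑[ ℓ < k ] isEquiparity i j ℓ
  equiparityCount-sum = begin
    equiparityCount A
      ≡⟨ listSum-filter equiparity? (ensemble A) ⟩
    ListAction.sum (List.map (indicator ∘ equiparity?) (ensemble A))
      ≡⟨ cong ListAction.sum (List.map-∘ (triples k)) ⟨
    ListAction.sum (List.map weight (triples k))
      ≡⟨ listSum-mapMaybe toTriple weight (List.cartesianProduct I (List.cartesianProduct I I)) ⟩
    ListAction.sum (List.map weight′ (List.cartesianProduct I (List.cartesianProduct I I)))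
      ≡⟨ trans (listSum-cartesianProduct weight′ I (List.cartesianProduct I I))
               (listSum-tabulate (λ i → ListAction.sum (List.map (λ jℓ → weight′ (i , jℓ))
                                                                 (List.cartesianProduct I I)))
                                 (λ i → i)) ⟩
    ∑[ i < k ] ListAction.sum (List.map (λ jℓ → weight′ (i , jℓ)) (List.cartesianProduct I I))
      ≡⟨ sum-cong (λ i → trans (listSum-cartesianProduct (λ jℓ → weight′ (i , jℓ)) I I)
           (listSum-tabulate (λ j → ListAction.sum (List.map (λ ℓ → weight′ (i , j , ℓ)) I)) (λ j → j))) ⟩
    ∑[ i < k ] ∑[ j < k ] ListAction.sum (List.map (λ ℓ → weight′ (i , j , ℓ)) I)
      ≡⟨ sum-cong₂ (λ i j → listSum-tabulate (λ ℓ → weight′ (i , j , ℓ)) (λ ℓ → ℓ)) ⟩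
    ∑[ i < k ] ∑[ j < k ] ∑[ ℓ < k ] isEquiparity i j ℓ ∎
    where
    open ≡-Reasoning
    I = List.allFin k
    weight : Triple k → ℕ
    weight (triple p q) = indicator (equiparity? (square A p q))
    weight′ : Fin k × Fin k × Fin k → ℕ
    weight′ = maybe′ weight 0 ∘ toTriple

  parities : Fin k → Fin k → Fin k → ℕ
  parities i j ℓ = bit (pairParity i j ℓ) + bit (pairParity j i ℓ) + bit (pairParity ℓ i j)

  -- The three parities sum to 1, so all of them are odd or exactly one is.
  isEquiparity-parities : n % 4 ≡ 2 ⊎ n % 4 ≡ 3 → ∀ i j ℓ →
    2 * isEquiparity i j ℓ + isLt (ord i j) * isLt (ord j ℓ) ≡
    isLt (ord i j) * isLt (ord j ℓ) * parities i j ℓ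
  isEquiparity-parities n%4 i j ℓ rewrite isLt-indicator i j | isLt-indicator j ℓ =
    decide (i <? j) (j <? ℓ)
    where
    open ≡-Reasoning
    count : ∀ x y z → x ℙ.+ y ℙ.+ z ≡ 1ℙ →
            2 * indicator ((x ℙ.≟ y) ×-dec (y ℙ.≟ z)) + 1 ≡ bit x + bit y + bit z
    count 0ℙ 0ℙ 1ℙ _ = refl
    count 0ℙ 1ℙ 0ℙ _ = refl
    count 1ℙ 0ℙ 0ℙ _ = refl
    count 1ℙ 1ℙ 1ℙ _ = refl

    -- The decisions that `toTriple` branches on also give the 0/1 factors after the rewriting, so
    -- both are abstracted together.
    decide : (p? : Dec (i Fin.< j)) (q? : Dec (j Fin.< ℓ)) →
      2 * maybe′ (λ (triple p q) → indicator (equiparity? (square A p q))) 0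
            (Maybe.map (λ (p , q) → triple p q) (dec⇒maybe (p? ×-dec q?)))
        + indicator p? * indicator q? ≡
      indicator p? * indicator q? * parities i j ℓ
    decide (no _)  _       = refl
    decide (yes _) (no _)  = refl
    decide (yes p) (yes q) = begin
      2 * indicator (equiparity? L) + 1
        ≡⟨ count (rowParity L) (columnParity L) (symbolParity L)
             (trans (cong₂ ℙ._+_ (cong₂ ℙ._+_ (rowParity-square p q) (columnParity-square p q))
                                 (symbolParity-square p q))
                    (pairParity-sum n%4 (Fin.<⇒≢ p) (Fin.<⇒≢ q) (Fin.<⇒≢ (Fin.<-trans p q)))) ⟩
      bit (rowParity L) + bit (columnParity L) + bit (symbolParity L)
        ≡⟨ cong₂ _+_ (cong₂ _+_ (cong bit (rowParity-square p q)) (cong bit (columnParity-square p q)))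
                     (cong bit (symbolParity-square p q)) ⟩
      parities i j ℓ
        ≡⟨ +-identityʳ (parities i j ℓ) ⟨
      parities i j ℓ + 0 ∎
      where L = square A p q

  -- The pairs a, b of odd parity at c form a complete bipartite graph on the remaining columns.
  pairParity-potential : (c j₀ : Fin k) → c ≢ j₀ → ∀ a b → c ≢ a → c ≢ b →
              pairParity c a b ≡ pairParity c j₀ a ℙ.+ pairParity c j₀ b
  pairParity-potential c j₀ c≢j₀ a b c≢a c≢b = trans (sym (pairParity-cocycle c≢a c≢j₀ c≢b))
    (cong (ℙ._+ pairParity c j₀ b) (pairParity-comm c a j₀))

-- Counting equiparity squares

∃-distinct : (c : Fin (2 + n)) → ∃[ j ] c ≢ j
∃-distinct zero    = suc zero , λ ()
∃-distinct (suc c) = zero , λ ()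

isNe-cong : (c a b : Fin k) {x y : ℕ} → (c ≢ a → c ≢ b → x ≡ y) →
            isNe (ord c a) * isNe (ord c b) * x ≡ isNe (ord c a) * isNe (ord c b) * y
isNe-cong c a b e with c ≟ a | c ≟ b
... | yes refl | _        rewrite ord-refl c = refl
... | no _     | yes refl rewrite ord-refl c | *-zeroʳ (isNe (ord c a)) = refl
... | no c≢a   | no c≢b   = cong (isNe (ord c a) * isNe (ord c b) *_) (e c≢a c≢b)

sum-cong₃ : {f g : Fin k → Fin k → Fin k → ℕ} → (∀ i j l → f i j l ≡ g i j l) →
            ∑[ i < k ] ∑[ j < k ] ∑[ l < k ] f i j l ≡ ∑[ i < k ] ∑[ j < k ] ∑[ l < k ] g i j l
sum-cong₃ e = sum-cong λ i → sum-cong₂ (e i)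

*-distribˡ-sum₃ : ∀ m (f : Fin k → Fin k → Fin k → ℕ) →
  m * (∑[ i < k ] ∑[ j < k ] ∑[ l < k ] f i j l) ≡ ∑[ i < k ] ∑[ j < k ] ∑[ l < k ] (m * f i j l)
*-distribˡ-sum₃ {k} m f =
  trans (*-distribˡ-sum m (λ i → ∑[ j < k ] ∑[ l < k ] f i j l)) (sum-cong λ i →
  trans (*-distribˡ-sum m (λ j → ∑[ l < k ] f i j l)) (sum-cong λ j → *-distribˡ-sum m (f i j)))

increasingTriples : ℕ → ℕ
increasingTriples k = ∑[ i < k ] ∑[ j < k ] ∑[ ℓ < k ] (isLt (ord i j) * isLt (ord j ℓ))

-- With `k = 2 + d`, `sum-square` gives `(k − 1)² = (k − 1) + 2 * pairs c` for every `c`, and the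
-- pairs summed over `c` count each triple three times. Hence `k (k − 1) + 6 T = k (k − 1)²`, to be
-- compared with `6*C3`.
increasingTriples≡C : ∀ d → increasingTriples (2 + d) ≡ (2 + d) C 3
increasingTriples≡C d = *-cancelˡ-≡ T (K C 3) 6 (+-cancelˡ-≡ (K * suc d) (6 * T) (6 * (K C 3)) (begin
  K * suc d + 6 * T
    ≡⟨ cong (λ m → K * suc d + m) (*-assoc 2 3 T) ⟩
  K * suc d + 2 * (3 * T)
    ≡⟨ cong₂ _+_ (sym (sum-const (λ (c : Fin K) → suc d) (suc d) λ _ → refl))
                 (trans (cong (2 *_) (sym pairs-triples)) (*-distribˡ-sum 2 pairs)) ⟩
  ∑[ c < K ] suc d + ∑[ c < K ] (2 * pairs c)
    ≡⟨ ∑-distrib-+ (λ (c : Fin K) → suc d) (λ c → 2 * pairs c) ⟨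
  ∑[ c < K ] (suc d + 2 * pairs c)
    ≡⟨ sum-const (λ c → suc d + 2 * pairs c) (suc d * suc d) pairs-square ⟩
  K * (suc d * suc d)
    ≡⟨ expand d ⟩
  K * suc d + K * suc d * d
    ≡⟨ cong (λ m → K * suc d + m) (6*C3 d) ⟨
  K * suc d + 6 * (K C 3) ∎))
  where
  open ≡-Reasoning
  K = suc (suc d)
  T = increasingTriples K

  expand : ∀ d → (2 + d) * ((1 + d) * (1 + d)) ≡ (2 + d) * (1 + d) + (2 + d) * (1 + d) * d
  expand = solve-∀

  pairs : Fin K → ℕ
  pairs c = ∑[ a < K ] ∑[ b < K ] (isLt (ord a b) * (isNe (ord c a) * isNe (ord c b)))

  isNe-idempotent : ∀ o → isNe o * isNe o ≡ isNe o
  isNe-idempotent lt = refl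
  isNe-idempotent eq = refl
  isNe-idempotent gt = refl

  pairs-square : ∀ c → suc d + 2 * pairs c ≡ suc d * suc d
  pairs-square c =
    subst (λ m → m + 2 * pairs c ≡ m * m) (sum-isNe c)
      (sym (sum-square (λ a → isNe (ord c a)) (λ a → isNe-idempotent (ord c a))))

  pairs-triples : sum pairs ≡ 3 * T
  pairs-triples = begin
    sum pairs
      ≡⟨ sum-cong₃ (λ (c a b : Fin K) → cong (isLt (ord a b) *_) (*-identityʳ (isNe (ord c a) * isNe (ord c b)))) ⟨
    ∑[ c < K ] ∑[ a < K ] ∑[ b < K ] (isLt (ord a b) * (isNe (ord c a) * isNe (ord c b) * 1))
      ≡⟨ sum-triples {K} (λ _ _ _ → 1) ⟩
    ∑[ i < K ] ∑[ j < K ] ∑[ ℓ < K ] (isLt (ord i j) * isLt (ord j ℓ) * 3)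
      ≡⟨ sum-cong₃ (λ (i j ℓ : Fin K) → *-comm (isLt (ord i j) * isLt (ord j ℓ)) 3) ⟩
    ∑[ i < K ] ∑[ j < K ] ∑[ ℓ < K ] (3 * (isLt (ord i j) * isLt (ord j ℓ)))
      ≡⟨ *-distribˡ-sum₃ 3 (λ (i j ℓ : Fin K) → isLt (ord i j) * isLt (ord j ℓ)) ⟨
    3 * T ∎

-- Multiplied by `d`, the upper bound becomes `6 * t * suc d`. Removing `4 * t * d` from both sides
-- leaves `2 * (t * (d + 3))`, as `6 (d + 1) − 4 d = 2 (d + 3)`.
eliminate-sum : ∀ x t s d → 2 * x + t ≡ s → 4 * s ≤ (2 + d) * (suc d * suc d) →
                6 * t ≡ (2 + d) * suc d * d → 4 * x * d ≤ t * (d + 3)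
eliminate-sum x t _ d refl bound 6t = *-cancelˡ-≤ 2 (+-cancelˡ-≤ (4 * t * d) _ _ (begin
  4 * t * d + 2 * (4 * x * d)
    ≡⟨ collect t x d ⟩
  4 * (2 * x + t) * d
    ≤⟨ *-monoˡ-≤ d bound ⟩
  (2 + d) * (suc d * suc d) * d
    ≡⟨ regroup d ⟩
  (2 + d) * suc d * d * suc d
    ≡⟨ cong (_* suc d) 6t ⟨
  6 * t * suc d
    ≡⟨ expand t d ⟩
  4 * t * d + 2 * (t * (d + 3)) ∎))
  where
  open ≤-Reasoning
  collect : ∀ t x d → 4 * t * d + 2 * (4 * x * d) ≡ 4 * (2 * x + t) * d
  collect = solve-∀
  regroup : ∀ d → (2 + d) * ((1 + d) * (1 + d)) * d ≡ (2 + d) * (1 + d) * d * (1 + d)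
  regroup = solve-∀
  expand : ∀ t d → 6 * t * (1 + d) ≡ 4 * t * d + 2 * (t * (d + 3))
  expand = solve-∀

module _ {d n : ℕ} (A : OA (2 + d) n) (n%4 : n % 4 ≡ 2 ⊎ n % 4 ≡ 3) where

  private
    K = 2 + d
    T = increasingTriples K
    E = equiparityCount A

  oddPairs : Fin K → ℕ
  oddPairs c =
    ∑[ a < K ] ∑[ b < K ] (isLt (ord a b) * (isNe (ord c a) * isNe (ord c b) * bit (pairParity A c a b)))

  -- The odd values of `pairParity` are counted by square and by column `c`; a square contributes 3
  -- if it is equiparity and 1 otherwise.
  equiparityCount-oddPairs : 2 * E + T ≡ sum oddPairs
  equiparityCount-oddPairs = begin
    2 * E + T
      ≡⟨ cong (λ m → 2 * m + T) (equiparityCount-sum A) ⟩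
    2 * (∑[ i < K ] ∑[ j < K ] ∑[ ℓ < K ] isEquiparity A i j ℓ) + T
      ≡⟨ cong (_+ T) (*-distribˡ-sum₃ 2 (isEquiparity A)) ⟩
    ∑[ i < K ] ∑[ j < K ] ∑[ ℓ < K ] (2 * isEquiparity A i j ℓ) + T
      ≡⟨ trans (sum-cong λ i → sum-distrib₂ (λ j ℓ → 2 * isEquiparity A i j ℓ)
                                          (λ (j ℓ : Fin K) → isLt (ord i j) * isLt (ord j ℓ)))
               (∑-distrib-+ (λ i → ∑[ j < K ] ∑[ ℓ < K ] (2 * isEquiparity A i j ℓ))
                            (λ i → ∑[ j < K ] ∑[ ℓ < K ] (isLt (ord i j) * isLt (ord j ℓ)))) ⟨
    ∑[ i < K ] ∑[ j < K ] ∑[ ℓ < K ] (2 * isEquiparity A i j ℓ + isLt (ord i j) * isLt (ord j ℓ))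
      ≡⟨ sum-cong₃ (isEquiparity-parities A n%4) ⟩
    ∑[ i < K ] ∑[ j < K ] ∑[ ℓ < K ] (isLt (ord i j) * isLt (ord j ℓ) * parities A i j ℓ)
      ≡⟨ sum-triples (λ c a b → bit (pairParity A c a b)) ⟨
    sum oddPairs ∎
    where open ≡-Reasoning

  -- Any other column `j₀` serves as base point: `pairParity A c j₀` two-colours the columns, and
  -- the odd pairs are the bichromatic ones. The weight `isNe (ord c a)` removes `c`, leaving total
  -- `suc d`, that is, `k − 1`.
  oddPairs-bound : ∀ c → 4 * oddPairs c ≤ suc d * suc d
  oddPairs-bound c with j₀ , c≢j₀ ← ∃-distinct c = begin
    4 * oddPairs c
      ≡⟨ cong (4 *_) (sum-cong₂ λ (a b : Fin K) → cong (isLt (ord a b) *_)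
           (isNe-cong c a b λ c≢a c≢b → cong bit (pairParity-potential A c j₀ c≢j₀ a b c≢a c≢b))) ⟩
    4 * (∑[ a < K ] ∑[ b < K ] (isLt (ord a b) * (isNe (ord c a) * isNe (ord c b) *
                                bit (pairParity A c j₀ a ℙ.+ pairParity A c j₀ b))))
      ≤⟨ cut-bound (λ a → isNe (ord c a)) (pairParity A c j₀) ⟩
    ∑[ a < K ] isNe (ord c a) * ∑[ a < K ] isNe (ord c a)
      ≡⟨ cong₂ _*_ (sum-isNe c) (sum-isNe c) ⟩
    suc d * suc d ∎
    where open ≤-Reasoning

  equiparityCount-bound : 4 * E * d ≤ (K C 3) * (d + 3)
  equiparityCount-bound = subst (λ m → 4 * E * d ≤ m * (d + 3)) (increasingTriples≡C d)
    (eliminate-sum E T (sum oddPairs) d equiparityCount-oddPairs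
      (subst (_≤ K * (suc d * suc d)) (sym (*-distribˡ-sum 4 oddPairs))
        (sum-bound (λ c → 4 * oddPairs c) (suc d * suc d) oddPairs-bound))
      (trans (cong (6 *_) (increasingTriples≡C d)) (6*C3 d)))

-- The bound over ℚ

-- With `suc d` for `k − 2`, the bound on `E / M` is `1/4 + 3 / (4 (k − 2))`. Once `k − 2 ≥ q`, the
-- excess is at most `3 / (4 q)`, which is below `suc p / q`.
absorb-error : ∀ E M d p q → 4 * E * suc d ≤ M * (suc d + 3) → q ≤ suc d →
               E * (4 * q) ≤ (q + suc p * 4) * M
absorb-error E M d p q bound q≤d = *-cancelʳ-≤ _ _ (suc d) (begin
  E * (4 * q) * suc d
    ≡⟨ regroup E q d ⟩
  q * (4 * E * suc d)
    ≤⟨ *-monoʳ-≤ q bound ⟩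
  q * (M * (suc d + 3))
    ≡⟨ expand q M d ⟩
  M * (q * suc d + q * 3)
    ≤⟨ *-monoʳ-≤ M (+-monoʳ-≤ (q * suc d) (≤-trans (*-monoˡ-≤ 3 q≤d) (slack p d))) ⟩
  M * (q * suc d + suc p * 4 * suc d)
    ≡⟨ collect M q p d ⟩
  (q + suc p * 4) * M * suc d ∎)
  where
  open ≤-Reasoning
  regroup : ∀ E q d → E * (4 * q) * (1 + d) ≡ q * (4 * E * (1 + d))
  regroup = solve-∀
  expand : ∀ q M d → q * (M * (1 + d + 3)) ≡ M * (q * (1 + d) + q * 3)
  expand = solve-∀
  collect : ∀ M q p d → M * (q * (1 + d) + (1 + p) * 4 * (1 + d)) ≡ (q + (1 + p) * 4) * M * (1 + d)
  collect = solve-∀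
  slack : ∀ p d → suc d * 3 ≤ suc p * 4 * suc d
  slack p d = subst (suc d * 3 ≤_) (split p d) (m≤m+n (suc d * 3) _)
    where
    split : ∀ p d → (1 + d) * 3 + (1 + 4 * p) * (1 + d) ≡ (1 + p) * 4 * (1 + d)
    split = solve-∀

open import Data.Integer.Base as ℤ using (+_; -[1+_])
import Data.Integer.Properties as ℤ
import Data.Rational.Properties as ℚ
open import Data.Rational.Unnormalised.Base as ℚᵘ using (mkℚᵘ)
import Data.Rational.Unnormalised.Properties as ℚᵘ

-- Over the denominator `4 * suc q`, the factor `1/4 + p / suc q` has numerator `suc q + p * 4`.
-- Unnormalised rationals avoid reduction to lowest terms, so clearing denominators leaves the
-- hypothesis.
fraction-bound : ∀ E M p q .(coprime : Coprime p (suc q)) → E * (4 * suc q) ≤ (suc q + p * 4) * M →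
  (+ E / 1) ℚ.≤ ((+ 1 / 4) ℚ.+ ℚ.mkℚ (+ p) q coprime) ℚ.* (+ M / 1)
fraction-bound E M p q coprime bound = ℚ.toℚᵘ-cancel-≤ (begin
  ℚ.toℚᵘ (+ E / 1)
    ≃⟨ ℚ.toℚᵘ-fromℚᵘ (mkℚᵘ (+ E) 0) ⟩
  mkℚᵘ (+ E) 0
    ≤⟨ ℚᵘ.*≤* integers ⟩
  (mkℚᵘ (+ 1) 3 ℚᵘ.+ mkℚᵘ (+ p) q) ℚᵘ.* mkℚᵘ (+ M) 0
    ≃⟨ ℚᵘ.*-congˡ {mkℚᵘ (+ 1) 3 ℚᵘ.+ mkℚᵘ (+ p) q} (ℚ.toℚᵘ-fromℚᵘ (mkℚᵘ (+ M) 0)) ⟨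
  (mkℚᵘ (+ 1) 3 ℚᵘ.+ mkℚᵘ (+ p) q) ℚᵘ.* ℚ.toℚᵘ (+ M / 1)
    ≃⟨ ℚᵘ.*-congʳ (ℚ.toℚᵘ-homo-+ (+ 1 / 4) ε) ⟨
  ℚ.toℚᵘ ((+ 1 / 4) ℚ.+ ε) ℚᵘ.* ℚ.toℚᵘ (+ M / 1)
    ≃⟨ ℚ.toℚᵘ-homo-* ((+ 1 / 4) ℚ.+ ε) (+ M / 1) ⟨
  ℚ.toℚᵘ (((+ 1 / 4) ℚ.+ ε) ℚ.* (+ M / 1)) ∎)
  where
  open ℚᵘ.≤-Reasoning
  ε = ℚ.mkℚ (+ p) q coprime
  integers : + E ℤ.* (+ (4 * suc q * 1)) ℤ.≤ (+ 1 ℤ.* + suc q ℤ.+ + p ℤ.* + 4) ℤ.* + M ℤ.* + 1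
  integers = subst₂ ℤ._≤_ (ℤ.pos-* E (4 * suc q * 1)) numerator
    (ℤ.+≤+ (subst (λ m → E * m ≤ (suc q + p * 4) * M) (sym (*-identityʳ (4 * suc q))) bound))
    where
    numerator : + ((suc q + p * 4) * M) ≡ (+ 1 ℤ.* + suc q ℤ.+ + p ℤ.* + 4) ℤ.* + M ℤ.* + 1
    numerator = sym (trans (ℤ.*-identityʳ _) (trans
      (cong (ℤ._* + M) (cong₂ ℤ._+_ (ℤ.*-identityˡ (+ suc q)) (sym (ℤ.pos-* p 4))))
      (sym (ℤ.pos-* (suc q + p * 4) M))))

theorem6p6 : ∀ (ε : ℚ) → 0ℚ ℚ.< ε →
    ∃[ K₀ ] (∀ (n k : ℕ) → n ≥ K₀ → k ≥ K₀ →
    3 ≤ k → k ≤ n + 1 →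
    n % 4 ≡ 2 ⊎ n % 4 ≡ 3 →
    ∀ (A : OA k n) →
    (+ equiparityCount A / 1) ℚ.≤ ((+ 1 / 4) ℚ.+ ε) ℚ.* (+ (k C 3) / 1))
theorem6p6 (ℚ.mkℚ (+ zero) _ _) (ℚ.*<* (ℤ.+<+ ()))
theorem6p6 (ℚ.mkℚ -[1+ _ ] _ _) (ℚ.*<* ())
-- Here `ε = suc p / suc q`, and `k ≥ 3 + q` says that `k − 2` is at least the denominator `suc q`.
theorem6p6 (ℚ.mkℚ (+ suc p) q coprime) _ = 3 + q , λ where
  n (suc (suc (suc d))) _ (s≤s (s≤s q≤d)) _ _ n%4 A →
    fraction-bound (equiparityCount A) ((3 + d) C 3) (suc p) q coprime
      (absorb-error (equiparityCount A) ((3 + d) C 3) d p (suc q) (equiparityCount-bound A n%4) q≤d)
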